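{- If $f$ is a problem that is parallelizable (i.e., $f\equiv_{\mathrm W}\Pi f$) and stashable (i.e., $f\equiv_{\mathrm W}\Sigma f$), then $f$ is also closed under upper Turing cones, i.e., $f\equiv_{\mathrm W}f^{\mathcal D}$.
   Context: A represented space is a set $X$ with a partial surjective map $\delta_X:\subseteq\mathbb N^{\mathbb N}\to X$. A problem is a partial multi-valued function $f:\subseteq X\rightrightarrows Y$ between represented spaces that has a realizer; a realizer of $f$ is a function $F:\subseteq\mathbb N^{\mathbb N}\to\mathbb N^{\mathbb N}$ with $\delta_YF(p)\in f\delta_X(p)$ for all $p\in\mathrm{dom}(f\delta_X)$. For $p,q\in\mathbb N^{\mathbb N}$, $\langle p,q\rangle(2n)=p(n)$, $\langle p,q\rangle(2n+1)=q(n)$. For problems $f,g$: $f\leq_{\mathrm W}g$ if there are computable $H,K:\subseteq\mathbb N^{\mathbb N}\to\mathbb N^{\mathbb N}$ such that $H\langle\mathrm{id},GK\rangle$ is a realizer of $f$ whenever $G$ is a realizer of $g$; $f\equiv_{\mathrm W}g$ means $f\leq_{\mathrm W}g$ and $g\leq_{\mathrm W}f$. For a represented space $Y$, the completion $\overline Y:=Y\cup\{\bot\}$ ($\bot\notin Y$) is represented by the total map $\delta_{\overline Y}$ with $\delta_{\overline Y}(p)=\delta_Y(p-1)$ if $p-1\in\mathrm{dom}(\delta_Y)$ and $\delta_{\overline Y}(p)=\bot$ otherwise, where $p-1\in\mathbb N^{\mathbb N}\cup\mathbb N^*$ is the concatenation of $p(0)-1,p(1)-1,\dots$ and $0-1$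 is the empty word. $X^{\mathbb N}$ is represented by $\langle p_0,p_1,\dots\rangle\mapsto(\delta_X(p_n))_n$, where $\langle p_0,p_1,\dots\rangle\langle n,k\rangle:=p_n(k)$ and $\langle n,k\rangle:=\frac12(n+k)(n+k+1)+k$ for $n,k\in\mathbb N$. For $f:\subseteq X\rightrightarrows Y$: the parallelization $\Pi f:\subseteq X^{\mathbb N}\rightrightarrows Y^{\mathbb N}$ has domain $\mathrm{dom}(f)^{\mathbb N}$ and $\Pi f((x_n)_n)=\{(y_n)_n:(\forall n)\ y_n\in f(x_n)\}$; the stashing $\Sigma f:\subseteq X^{\mathbb N}\rightrightarrows\overline Y^{\mathbb N}$ has domain $\mathrm{dom}(f)^{\mathbb N}$ and $\Sigma f((x_n)_n)=\{(y_n)_n\in\overline Y^{\mathbb N}:(\exists n)\ y_n\in f(x_n)\}$. $\mathcal D$ is the set of Turing degrees $\deg_{\mathrm T}(p)=\{q\in\mathbb N^{\mathbb N}:q\equiv_{\mathrm T}p\}$, represented by $\delta_{\mathcal D}(p)=\deg_{\mathrm T}(p)$. For $y$ in a represented space $(Y,\delta_Y)$ and $q\in\mathbb N^{\mathbb N}$, $y\leq_{\mathrm T}q$ means that some name $p\in\delta_Y^{ -1}\{y\}$ satisfies $p\leq_{\mathrm T}q$. The upper Turing cone version of $f:\subseteq X\rightrightarrows Y$ is $f^{\mathcal D}:\subseteq X\rightrightarrows\mathcal D$ with $\mathrm{dom}(f^{\mathcal D})=\mathrm{dom}(f)$ and $f^{\mathcal D}(x)=\{\deg_{\mathrm T}(q):(\exists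 y\leq_{\mathrm T}q)\ y\in f(x)\}$. -}

module Defs where

open import Axiom.ExcludedMiddle using (ExcludedMiddle)
open import Data.Empty using (⊥-elim)
open import Data.List.Base using (List; []; _∷_; length; concatMap; applyUpTo)
open import Data.List.Properties using (length-applyUpTo)
open import Data.Maybe.Base using (Maybe; just; nothing)
open import Data.Maybe.Relation.Binary.Pointwise as Pointwise using (Pointwise; just; nothing)
open import Data.Nat.Base using (ℕ; zero; suc; _+_; _*_; _/_; _≤_; _<_; s≤s)
open import Data.Nat.DivMod using (+-distrib-/-∣ʳ; m*n/n≡m)
open import Data.Nat.Divisibility using (divides)
open import Data.Nat.Properties using (+-suc; +-identityʳ; suc-injective; ≤-reflexive)
open import Data.Nat.Solver using (module +-*-Solver)
open import Data.Product.Base using (∃-syntax; _×_; _,_; proj₁; proj₂)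
open import Function.Base using (_∘_)
open import Level using (0ℓ)
open import Relation.Binary.Bundles using (Setoid)
open import Relation.Binary.PropositionalEquality
  using (_≡_; refl; sym; trans; cong; cong₂; subst; _≗_; module ≡-Reasoning)
open import Relation.Nullary using (¬_; yes; no)

Baire : Set
Baire = ℕ → ℕ

------------------------------------------------------------------------
-- Pairing of numbers and of sequences

pair : ℕ → ℕ → ℕ
pair n k = (n + k) * suc (n + k) / 2 + k

unpair : ℕ → ℕ × ℕ
unpair zero    = 0 , 0
unpair (suc z) with unpair z
... | zero  , k = suc k , 0
... | suc n , k = n , suc k

triangle-suc : ∀ s → suc s * suc (suc s) / 2 ≡ s * suc s / 2 + suc s
triangle-suc s = begin
  suc s * suc (suc s) / 2        ≡⟨ cong (_/ 2) (expand s) ⟩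
  (s * suc s + suc s * 2) / 2    ≡⟨ +-distrib-/-∣ʳ (s * suc s) (divides (suc s) refl) ⟩
  s * suc s / 2 + suc s * 2 / 2  ≡⟨ cong (s * suc s / 2 +_) (m*n/n≡m (suc s) 2) ⟩
  s * suc s / 2 + suc s          ∎
  where
  open ≡-Reasoning
  open +-*-Solver
  expand : ∀ s → suc s * suc (suc s) ≡ s * suc s + suc s * 2
  expand = solve 1 (λ s → (con 1 :+ s) :* (con 2 :+ s)
                       := s :* (con 1 :+ s) :+ (con 1 :+ s) :* con 2) refl

pair-up : ∀ n k → pair n (suc k) ≡ suc (pair (suc n) k)
pair-up n k rewrite +-suc n k = +-suc _ k

pair-wrap : ∀ k → pair (suc k) 0 ≡ suc (pair 0 k)
pair-wrap k rewrite +-identityʳ k =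
  trans (+-identityʳ _) (trans (triangle-suc k) (+-suc _ k))

pair-unpair : ∀ z → pair (proj₁ (unpair z)) (proj₂ (unpair z)) ≡ z
pair-unpair zero = refl
pair-unpair (suc z) with unpair z | pair-unpair z
... | zero  , k | eq = trans (pair-wrap k) (cong suc eq)
... | suc n , k | eq = trans (pair-up n k) (cong suc eq)

unpair-pair : ∀ n k → unpair (pair n k) ≡ (n , k)
unpair-pair n k = go (pair n k) n k refl
  where
  go : ∀ z n k → pair n k ≡ z → unpair z ≡ (n , k)
  go zero    zero    zero    _  = refl
  go zero    (suc n) zero    eq with () ← trans (sym (pair-wrap n)) eq
  go zero    n       (suc k) eq with () ← trans (sym (pair-up n k)) eq
  go (suc z) zero    zero    ()
  go (suc z) (suc n) zero    eq
    rewrite go z 0 n (suc-injective (trans (sym (pair-wrap n)) eq)) = refl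
  go (suc z) n       (suc k) eq
    rewrite go z (suc n) k (suc-injective (trans (sym (pair-up n k)) eq)) = refl

interleave : Baire → Baire → Baire
interleave p q zero    = p 0
interleave p q (suc n) = interleave q (p ∘ suc) n

interleave-even : ∀ p q n → interleave p q (2 * n) ≡ p n
interleave-even p q zero = refl
interleave-even p q (suc n) rewrite +-suc n (n + 0) =
  interleave-even (p ∘ suc) (q ∘ suc) n

interleave-odd : ∀ p q n → interleave p q (suc (2 * n)) ≡ q n
interleave-odd p q n = interleave-even q (p ∘ suc) n

interleave-cong : ∀ {p p′ q q′} → p ≗ p′ → q ≗ q′ → interleave p q ≗ interleave p′ q′
interleave-cong e d zero    = e 0
interleave-cong e d (suc n) = interleave-cong d (e ∘ suc) n

-- row n ⟨p₀, p₁, …⟩ = pₙ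
row : ℕ → Baire → Baire
row n p k = p (pair n k)

tuple : (ℕ → Baire) → Baire
tuple ps z = ps (proj₁ (unpair z)) (proj₂ (unpair z))

row-tuple : ∀ ps n → row n (tuple ps) ≗ ps n
row-tuple ps n k = cong (λ w → ps (proj₁ w) (proj₂ w)) (unpair-pair n k)

rows-injective : ∀ {p q} → (∀ n → row n p ≗ row n q) → p ≗ q
rows-injective {p} {q} h z =
  subst (λ w → p w ≡ q w) (pair-unpair z) (h (proj₁ (unpair z)) (proj₂ (unpair z)))

------------------------------------------------------------------------
-- Computability relative to an oracle

-- Codes for the partial recursive functions ℕ ⇀ ℕ relative to an oracle,
-- with several arguments passed as one number by means of `pair`.
data Code : Set where
  zero succ left right oracle : Code
  pairing comp prec           : Code → Code → Code
  rfind                       : Code → Code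

-- Eval p c x y: the program c with oracle p halts on input x with output y.
-- prec computes h(a,0) = c(a), h(a,n+1) = d(a,(n,h(a,n))); rfind computes the
-- least n with c(a,n) = 0, all c(a,m) for m < n being defined.
data Eval (p : Baire) : Code → ℕ → ℕ → Set where
  zero    : ∀ {x} → Eval p zero x 0
  succ    : ∀ {x} → Eval p succ x (suc x)
  left    : ∀ m n → Eval p left (pair m n) m
  right   : ∀ m n → Eval p right (pair m n) n
  oracle  : ∀ {x} → Eval p oracle x (p x)
  pairing : ∀ {c d x y z} → Eval p c x y → Eval p d x z → Eval p (pairing c d) x (pair y z)
  comp    : ∀ {c d x y z} → Eval p d x y → Eval p c y z → Eval p (comp c d) x z
  prec-0  : ∀ {c d y} a → Eval p c a y → Eval p (prec c d) (pair a 0) y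
  prec-s  : ∀ {c d y z} a n → Eval p (prec c d) (pair a n) y →
            Eval p d (pair a (pair n y)) z → Eval p (prec c d) (pair a (suc n)) z
  rfind   : ∀ {c a} n (k : ℕ → ℕ) → (∀ m → m < n → Eval p c (pair a m) (suc (k m))) →
            Eval p c (pair a n) 0 → Eval p (rfind c) a n

Computes : Code → Baire → Baire → Set
Computes c p q = ∀ n → Eval p c n (q n)

infix 4 _≤T_ _≡T_

_≤T_ : Baire → Baire → Set
q ≤T p = ∃[ c ] Computes c p q

_≡T_ : Baire → Baire → Set
p ≡T q = p ≤T q × q ≤T p

≤T-reflexive : ∀ {p q} → p ≗ q → p ≤T q
≤T-reflexive {p} {q} e = oracle , λ n → subst (Eval q oracle n) (sym (e n)) oracle

replaceOracle : Code → Code → Code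
replaceOracle d zero           = zero
replaceOracle d succ           = succ
replaceOracle d left           = left
replaceOracle d right          = right
replaceOracle d oracle         = d
replaceOracle d (pairing c c′) = pairing (replaceOracle d c) (replaceOracle d c′)
replaceOracle d (comp c c′)    = comp (replaceOracle d c) (replaceOracle d c′)
replaceOracle d (prec c c′)    = prec (replaceOracle d c) (replaceOracle d c′)
replaceOracle d (rfind c)      = rfind (replaceOracle d c)

Eval-replaceOracle : ∀ {p q d c x y} → Computes d p q → Eval q c x y →
                     Eval p (replaceOracle d c) x y
Eval-replaceOracle h zero          = zero
Eval-replaceOracle h succ          = succ
Eval-replaceOracle h (left m n)    = left m n
Eval-replaceOracle h (right m n)   = right m n
Eval-replaceOracle h oracle        = h _
Eval-replaceOracle h (pairing e f) = pairing (Eval-replaceOracle h e) (Eval-replaceOracle h f)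
Eval-replaceOracle h (comp e f)    = comp (Eval-replaceOracle h e) (Eval-replaceOracle h f)
Eval-replaceOracle h (prec-0 a e)  = prec-0 a (Eval-replaceOracle h e)
Eval-replaceOracle h (prec-s a n e f) =
  prec-s a n (Eval-replaceOracle h e) (Eval-replaceOracle h f)
Eval-replaceOracle h (rfind n k e f) =
  rfind n k (λ m m<n → Eval-replaceOracle h (e m m<n)) (Eval-replaceOracle h f)

≤T-trans : ∀ {p q r} → p ≤T q → q ≤T r → p ≤T r
≤T-trans (c , hc) (d , hd) = replaceOracle d c , λ n → Eval-replaceOracle hd (hc n)

≡T-reflexive : ∀ {p q} → p ≗ q → p ≡T q
≡T-reflexive e = ≤T-reflexive e , ≤T-reflexive (sym ∘ e)

≡T-sym : ∀ {p q} → p ≡T q → q ≡T p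
≡T-sym (a , b) = b , a

≡T-trans : ∀ {p q r} → p ≡T q → q ≡T r → p ≡T r
≡T-trans (a , b) (c , d) = ≤T-trans a c , ≤T-trans d b

------------------------------------------------------------------------
-- Partial functions on Baire space

-- A partial function is given by its graph; two points of Baire space are
-- identified when they are pointwise equal.
record PartialFunction : Set₁ where
  field
    Graph      : Baire → Baire → Set
    resp       : ∀ {p p′ r r′} → p ≗ p′ → r ≗ r′ → Graph p r → Graph p′ r′
    functional : ∀ {p r r′} → Graph p r → Graph p r′ → r ≗ r′

open PartialFunction public using (Graph)

-- The code is unconstrained outside the domain of F.
Computable : PartialFunction → Set
Computable F = ∃[ c ] ∀ p r → Graph F p r → Computes c p r

idₚ : PartialFunction
idₚ = record
  { Graph      = _≗_
  ; resp       = λ e d h n → trans (sym (e n)) (trans (h n) (d n))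
  ; functional = λ h h′ n → trans (sym (h n)) (h′ n)
  }

infixr 9 _∘ₚ_

_∘ₚ_ : PartialFunction → PartialFunction → PartialFunction
F ∘ₚ G = record
  { Graph      = λ p r → ∃[ s ] Graph G p s × Graph F s r
  ; resp       = λ { e d (s , g , f) → s , G.resp e (λ _ → refl) g , F.resp (λ _ → refl) d f }
  ; functional = λ { (s , g , f) (s′ , g′ , f′) →
                     F.functional f (F.resp (sym ∘ G.functional g g′) (λ _ → refl) f′) }
  }
  where
  module F = PartialFunction F
  module G = PartialFunction G

⟨_,_⟩ₚ : PartialFunction → PartialFunction → PartialFunction
⟨ F , G ⟩ₚ = record
  { Graph      = λ p r → ∃[ a ] ∃[ b ] Graph F p a × Graph G p b × r ≗ interleave a b
  ; resp       = λ { e d (a , b , f , g , h) →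
                     a , b , F.resp e (λ _ → refl) f , G.resp e (λ _ → refl) g ,
                     λ n → trans (sym (d n)) (h n) }
  ; functional = λ { (a , b , f , g , h) (a′ , b′ , f′ , g′ , h′) n →
                     trans (h n)
                       (trans (interleave-cong (F.functional f f′) (G.functional g g′) n)
                              (sym (h′ n))) }
  }
  where
  module F = PartialFunction F
  module G = PartialFunction G

------------------------------------------------------------------------
-- Represented spaces

-- p ⊩ x means that p ∈ dom(δ) and δ(p) = x; equality of points is the setoid
-- equality.
record RepresentedSpace : Set₁ where
  infix 4 _⊩_
  field
    setoid : Setoid 0ℓ 0ℓ
  open Setoid setoid public
    using (Carrier; _≈_)
    renaming (refl to ≈-refl; sym to ≈-sym; trans to ≈-trans)
  field
    _⊩_        : Baire → Carrier → Set
    resp       : ∀ {p p′ x x′} → p ≗ p′ → x ≈ x′ → p ⊩ x → p′ ⊩ x′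
    functional : ∀ {p x x′} → p ⊩ x → p ⊩ x′ → x ≈ x′
    surjective : ∀ x → ∃[ p ] p ⊩ x

open RepresentedSpace public using (Carrier)

-- y ≤T q for a point y of a represented space
PointBelow : (Y : RepresentedSpace) → Carrier Y → Baire → Set
PointBelow Y y q = ∃[ p ] p ⊩ y × p ≤T q
  where open RepresentedSpace Y

-- The Turing degrees, as Baire space modulo Turing equivalence: the element q
-- of the carrier stands for deg_T(q).
𝒟 : RepresentedSpace
𝒟 = record
  { setoid = record
    { Carrier       = Baire
    ; _≈_           = _≡T_
    ; isEquivalence = record
      { refl  = ≡T-reflexive (λ _ → refl)
      ; sym   = ≡T-sym
      ; trans = ≡T-trans
      }
    }
  ; _⊩_        = _≡T_
  ; resp       = λ e d h → ≡T-trans (≡T-reflexive (sym ∘ e)) (≡T-trans h d)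
  ; functional = λ h h′ → ≡T-trans (≡T-sym h) h′
  ; surjective = λ q → q , ≡T-reflexive (λ _ → refl)
  }

infix 10 _^ℕ

_^ℕ : RepresentedSpace → RepresentedSpace
X ^ℕ = record
  { setoid = record
    { Carrier       = ℕ → X.Carrier
    ; _≈_           = λ xs ys → ∀ n → xs n X.≈ ys n
    ; isEquivalence = record
      { refl  = λ n → X.≈-refl
      ; sym   = λ e n → X.≈-sym (e n)
      ; trans = λ e d n → X.≈-trans (e n) (d n)
      }
    }
  ; _⊩_        = λ p xs → ∀ n → row n p X.⊩ xs n
  ; resp       = λ e d h n → X.resp (λ k → e (pair n k)) (d n) (h n)
  ; functional = λ h h′ n → X.functional (h n) (h′ n)
  ; surjective = λ xs →
      tuple (proj₁ ∘ X.surjective ∘ xs) ,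
      λ n → X.resp (sym ∘ row-tuple (proj₁ ∘ X.surjective ∘ xs) n) X.≈-refl (proj₂ (X.surjective (xs n)))
  }
  where module X = RepresentedSpace X

-- The word k - 1, where 0 - 1 is empty.
letter-1 : ℕ → List ℕ
letter-1 zero    = []
letter-1 (suc k) = k ∷ []

-- The finite word obtained from the first n values of p.
prefix-1 : Baire → ℕ → List ℕ
prefix-1 p n = concatMap letter-1 (applyUpTo p n)

infix 4 _-1≡_

-- The word p - 1 is infinite and equal to q.
_-1≡_ : Baire → Baire → Set
p -1≡ q = (∀ n → prefix-1 p n ≡ applyUpTo q (length (prefix-1 p n)))
        × (∀ m → ∃[ n ] m ≤ length (prefix-1 p n))

applyUpTo-cong : ∀ {p q : Baire} → p ≗ q → ∀ n → applyUpTo p n ≡ applyUpTo q n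
applyUpTo-cong e zero    = refl
applyUpTo-cong e (suc n) = cong₂ _∷_ (e 0) (applyUpTo-cong (e ∘ suc) n)

applyUpTo-injective : ∀ {p q : Baire} {m n} → applyUpTo p n ≡ applyUpTo q n → m < n → p m ≡ q m
applyUpTo-injective {m = zero}  {suc n} e _ = head e
  where
  head : ∀ {x y : ℕ} {xs ys} → x ∷ xs ≡ y ∷ ys → x ≡ y
  head refl = refl
applyUpTo-injective {m = suc m} {suc n} e (s≤s m<n) = applyUpTo-injective (tail e) m<n
  where
  tail : ∀ {x y : ℕ} {xs ys} → x ∷ xs ≡ y ∷ ys → xs ≡ ys
  tail refl = refl

-1≡-resp : ∀ {p p′ q q′} → p ≗ p′ → q ≗ q′ → p -1≡ q → p′ -1≡ q′
-1≡-resp {p} {p′} {q} {q′} e d (h , u) = h′ , u′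
  where
  eq : ∀ n → prefix-1 p n ≡ prefix-1 p′ n
  eq n = cong (concatMap letter-1) (applyUpTo-cong e n)
  h′ : ∀ n → prefix-1 p′ n ≡ applyUpTo q′ (length (prefix-1 p′ n))
  h′ n = subst (λ w → w ≡ applyUpTo q′ (length w)) (eq n) (trans (h n) (applyUpTo-cong d _))
  u′ : ∀ m → ∃[ n ] m ≤ length (prefix-1 p′ n)
  u′ m with n , le ← u m = n , subst (λ w → m ≤ length w) (eq n) le

-1≡-functional : ∀ {p q q′} → p -1≡ q → p -1≡ q′ → q ≗ q′
-1≡-functional (h , u) (h′ , _) m with n , le ← u (suc m) =
  applyUpTo-injective (trans (sym (h n)) (h′ n)) le

prefix-1-suc : ∀ q n → prefix-1 (suc ∘ q) n ≡ applyUpTo q n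
prefix-1-suc q zero    = refl
prefix-1-suc q (suc n) = cong (q 0 ∷_) (prefix-1-suc (q ∘ suc) n)

suc-1≡ : ∀ q → (suc ∘ q) -1≡ q
suc-1≡ q = (λ n → trans (prefix-1-suc q n) (cong (applyUpTo q) (sym (len n))))
         , (λ m → m , ≤-reflexive (sym (len m)))
  where
  len : ∀ n → length (prefix-1 (suc ∘ q) n) ≡ n
  len n = trans (cong length (prefix-1-suc q n)) (length-applyUpTo q n)

prefix-1-zero : ∀ n → prefix-1 (λ _ → 0) n ≡ []
prefix-1-zero zero    = refl
prefix-1-zero (suc n) = prefix-1-zero n

-- The bottom element is `nothing`. The representation is total, but seeing that
-- takes excluded middle (Completion-total).
Completion : RepresentedSpace → RepresentedSpace
Completion Y = record
  { setoid     = Pointwise.setoid Y.setoid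
  ; _⊩_        = _⊩_
  ; resp       = resp
  ; functional = functional
  ; surjective = surjective
  }
  where
  module Y = RepresentedSpace Y

  _⊩_ : Baire → Maybe Y.Carrier → Set
  p ⊩ just y  = ∃[ q ] p -1≡ q × q Y.⊩ y
  p ⊩ nothing = ¬ (∃[ q ] p -1≡ q × (∃[ y ] q Y.⊩ y))

  resp : ∀ {p p′ x x′} → p ≗ p′ → Pointwise Y._≈_ x x′ → p ⊩ x → p′ ⊩ x′
  resp e (just d) (q , s , h) = q , -1≡-resp e (λ _ → refl) s , Y.resp (λ _ → refl) d h
  resp e nothing  ¬h (q , s , h) = ¬h (q , -1≡-resp (sym ∘ e) (λ _ → refl) s , h)

  functional : ∀ {p x x′} → p ⊩ x → p ⊩ x′ → Pointwise Y._≈_ x x′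
  functional {x = just _}  {just _}  (q , s , h) (q′ , s′ , h′) =
    just (Y.functional h (Y.resp (-1≡-functional s′ s) Y.≈-refl h′))
  functional {x = just y}  {nothing} (q , s , h) ¬h = ⊥-elim (¬h (q , s , y , h))
  functional {x = nothing} {just y}  ¬h (q , s , h) = ⊥-elim (¬h (q , s , y , h))
  functional {x = nothing} {nothing} _ _ = nothing

  surjective : ∀ x → ∃[ p ] p ⊩ x
  surjective (just y) with q , h ← Y.surjective y = suc ∘ q , q , suc-1≡ q , h
  surjective nothing = (λ _ → 0) , λ { (q , (_ , u) , _) → absurd (u 1) }
    where
    absurd : ¬ (∃[ n ] 1 ≤ length (prefix-1 (λ _ → 0) n))
    absurd (n , le) with () ← subst (λ w → 1 ≤ length w) (prefix-1-zero n) le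

Completion-total : ExcludedMiddle 0ℓ → (Y : RepresentedSpace) →
                   let open RepresentedSpace (Completion Y) using (_⊩_) in
                   ∀ p → ∃[ x ] p ⊩ x
Completion-total em Y p with em {∃[ q ] p -1≡ q × (∃[ y ] RepresentedSpace._⊩_ Y q y)}
... | yes (q , s , y , h) = just y , q , s , h
... | no ¬h               = nothing , ¬h

------------------------------------------------------------------------
-- Problems and Weihrauch reducibility

-- Rel x y means y ∈ f(x); the domain of f is { x : f(x) ≠ ∅ }.
record MultiFunction (X Y : RepresentedSpace) : Set₁ where
  private
    module X = RepresentedSpace X
    module Y = RepresentedSpace Y
  field
    Rel  : X.Carrier → Y.Carrier → Set
    resp : ∀ {x x′ y y′} → x X.≈ x′ → y Y.≈ y′ → Rel x y → Rel x′ y′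

  Dom : X.Carrier → Set
  Dom x = ∃[ y ] Rel x y

Realizes : {X Y : RepresentedSpace} → PartialFunction → MultiFunction X Y → Set
Realizes {X} {Y} F f =
  ∀ p x → p X.⊩ x → f.Dom x → ∃[ r ] Graph F p r × (∃[ y ] r Y.⊩ y × f.Rel x y)
  where
  module X = RepresentedSpace X
  module Y = RepresentedSpace Y
  module f = MultiFunction f

record Problem (X Y : RepresentedSpace) : Set₁ where
  field
    multiFunction : MultiFunction X Y
    realizer      : ∃[ F ] Realizes F multiFunction
  open MultiFunction multiFunction public

open Problem public using (multiFunction)

infix 4 _≤W_ _≡W_

_≤W_ : {X Y U V : RepresentedSpace} → Problem X Y → Problem U V → Set₁
f ≤W g = ∃[ H ] ∃[ K ] Computable H × Computable K ×
  (∀ G → Realizes G (multiFunction g) →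
         Realizes (H ∘ₚ ⟨ idₚ , G ∘ₚ K ⟩ₚ) (multiFunction f))

_≡W_ : {X Y U V : RepresentedSpace} → Problem X Y → Problem U V → Set₁
f ≡W g = f ≤W g × g ≤W f

------------------------------------------------------------------------
-- Parallelization, stashing and upper Turing cones

-- The domain of the relation below is dom(f)^ℕ.
Parallelization : {X Y : RepresentedSpace} → Problem X Y → Problem (X ^ℕ) (Y ^ℕ)
Parallelization {X} {Y} f = record
  { multiFunction = Πf
  ; realizer      = F^ℕ , realizes
  }
  where
  module Y = RepresentedSpace Y
  module f = Problem f
  F = proj₁ f.realizer
  module F = PartialFunction F

  Πf : MultiFunction (X ^ℕ) (Y ^ℕ)
  Πf = record
    { Rel  = λ xs ys → ∀ n → f.Rel (xs n) (ys n)
    ; resp = λ e d h n → f.resp (e n) (d n) (h n)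
    }

  F^ℕ : PartialFunction
  F^ℕ = record
    { Graph      = λ p r → ∀ n → Graph F (row n p) (row n r)
    ; resp       = λ e d h n → F.resp (λ k → e (pair n k)) (λ k → d (pair n k)) (h n)
    ; functional = λ h h′ → rows-injective (λ n → F.functional (h n) (h′ n))
    }

  realizes : Realizes F^ℕ Πf
  realizes p xs hp (ys , hy) =
    tuple (proj₁ ∘ out)
    , (λ n → F.resp (λ _ → refl) (sym ∘ row-tuple (proj₁ ∘ out) n) (proj₁ (proj₂ (out n))))
    , (λ n → proj₁ (proj₂ (proj₂ (out n))))
    , (λ n → Y.resp (sym ∘ row-tuple (proj₁ ∘ out) n) Y.≈-refl
                    (proj₁ (proj₂ (proj₂ (proj₂ (out n))))))
    , (λ n → proj₂ (proj₂ (proj₂ (proj₂ (out n)))))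
    where
    out : ∀ n → ∃[ r ] Graph F (row n p) r × (∃[ y ] r Y.⊩ y × f.Rel (xs n) y)
    out n = proj₂ f.realizer (row n p) (xs n) (hp n) (ys n , hy n)

-- The first conjunct of the relation below restricts the domain to dom(f)^ℕ.
Stashing : {X Y : RepresentedSpace} → Problem X Y → Problem (X ^ℕ) (Completion Y ^ℕ)
Stashing {X} {Y} f = record
  { multiFunction = Σf
  ; realizer      = S , realizes
  }
  where
  module Y = RepresentedSpace Y
  module Ȳ = RepresentedSpace (Completion Y)
  module f = Problem f
  module Πf = Problem (Parallelization f)
  F = proj₁ Πf.realizer
  module F = PartialFunction F

  Σf : MultiFunction (X ^ℕ) (Completion Y ^ℕ)
  Σf = record
    { Rel  = λ xs ys → (∀ n → f.Dom (xs n)) × (∃[ n ] ∃[ y ] ys n Ȳ.≈ just y × f.Rel (xs n) y)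
    ; resp = λ { e d (h , n , y , eq , r) →
                 (λ m → proj₁ (h m) , f.resp (e m) Y.≈-refl (proj₂ (h m)))
                 , n , y , Ȳ.≈-trans (Ȳ.≈-sym (d n)) eq , f.resp (e n) Y.≈-refl r }
    }

  S : PartialFunction
  S = record
    { Graph      = λ p r → ∃[ s ] Graph F p s × r ≗ suc ∘ s
    ; resp       = λ { {p} {p′} e d (s , h , eq) →
                       s , F.resp {p} {p′} {s} {s} e (λ _ → refl) h , λ n → trans (sym (d n)) (eq n) }
    ; functional = λ { {p} (s , h , eq) (s′ , h′ , eq′) n →
                       trans (eq n) (trans (cong suc (F.functional {p} {s} {s′} h h′ n)) (sym (eq′ n))) }
    }

  realizes : Realizes S Σf
  realizes p xs hp (_ , dom , _)
    with s , g , ys , hs , hy ← proj₂ Πf.realizer p xs hp ((λ n → proj₁ (dom n)) , (λ n → proj₂ (dom n)))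
    = suc ∘ s , (s , g , λ _ → refl) , just ∘ ys
    , (λ n → row n s , suc-1≡ (row n s) , hs n)
    , dom , 0 , ys 0 , Ȳ.≈-refl , hy 0

infix 10 _^𝒟

_^𝒟 : {X Y : RepresentedSpace} → Problem X Y → Problem X 𝒟
_^𝒟 {X} {Y} f = record
  { multiFunction = f𝒟
  ; realizer      = proj₁ f.realizer , realizes
  }
  where
  module Y = RepresentedSpace Y
  module f = Problem f

  f𝒟 : MultiFunction X 𝒟
  f𝒟 = record
    { Rel  = λ x d → ∃[ q ] d ≡T q × (∃[ y ] PointBelow Y y q × f.Rel x y)
    ; resp = λ { e d (q , h , y , b , r) →
                 q , ≡T-trans (≡T-sym d) h , y , b , f.resp e Y.≈-refl r }
    }

  realizes : Realizes (proj₁ f.realizer) f𝒟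
  realizes p x hp (_ , _ , _ , y₀ , _ , r₀)
    with r , g , y , hr , h ← proj₂ f.realizer p x hp (y₀ , r₀)
    = r , g , r , ≡T-reflexive (λ _ → refl)
    , r , ≡T-reflexive (λ _ → refl) , y , (r , hr , ≤T-reflexive (λ _ → refl)) , h

Parallelizable : {X Y : RepresentedSpace} → Problem X Y → Set₁
Parallelizable f = f ≡W Parallelization f

Stashable : {X Y : RepresentedSpace} → Problem X Y → Set₁
Stashable f = f ≡W Stashing f

ClosedUnderUpperTuringCones : {X Y : RepresentedSpace} → Problem X Y → Set₁
ClosedUnderUpperTuringCones f = f ≡W f ^𝒟

{-# OPTIONS --safe #-}

-- We have f ≤ Σf ≤ (Πf)^𝒟 ≤ f^𝒟. For the second step, a degree in (Πf)^𝒟(xs)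
-- computes a name of some ys ∈ Πf(xs); not knowing by which program, we let the
-- n-th component of the stashing output be the n-th component of the sequence
-- computed by program n, padded with zeros while it runs. At the index of the
-- right program this is a correct answer, and elsewhere every sequence names a
-- point of the completion. The last step holds since f ≤ g via H, K gives
-- f^𝒟 ≤ g^𝒟: if v computes a name r of a point of g(K p), then ⟨p, v⟩ computes H⟨p, r⟩.
module Submission where

open import Level using (0ℓ)
open import Axiom.ExcludedMiddle using (ExcludedMiddle)
open import Defs
open import Data.Empty using (⊥-elim)
open import Data.Fin.Base using (Fin; zero; suc)
open import Data.Fin using (#_)
open import Data.List.Base using (List; []; _∷_; _++_; length; applyUpTo; concatMap)
open import Data.Nat.Base using (ℕ; zero; suc; _+_; _*_; _≤_; _<_; z≤n; s≤s)
open import Data.Nat.Properties using (+-suc; +-identityʳ; m≤n+m)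
open import Data.Product.Base using (∃-syntax; _×_; _,_; proj₁; proj₂)
open import Data.Sum.Base using (_⊎_; inj₁; inj₂)
open import Data.Vec.Base using (Vec; []; _∷_; lookup)
open import Function.Base using (_∘_)
open import Relation.Binary.PropositionalEquality
  using (_≡_; refl; sym; trans; cong; cong₂; subst; _≗_)
open import Relation.Nullary using (¬_; yes; no)

-- Pairing and projections as programs

-- Left transparent, `pair` is unfolded down to division by unification, which
-- then fails to solve for its arguments.
opaque
  infixr 4 ⟪_,_⟫

  ⟪_,_⟫ : ℕ → ℕ → ℕ
  ⟪ m , n ⟫ = pair m n

  ⟪⟫-pair : ∀ m n → ⟪ m , n ⟫ ≡ pair m n
  ⟪⟫-pair m n = refl

  unpair-⟪⟫ : ∀ m n → unpair ⟪ m , n ⟫ ≡ (m , n)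
  unpair-⟪⟫ = unpair-pair

  ⟪⟫-unpair : ∀ z → ⟪ proj₁ (unpair z) , proj₂ (unpair z) ⟫ ≡ z
  ⟪⟫-unpair = pair-unpair

  Eval-left : ∀ {p m n} → Eval p left ⟪ m , n ⟫ m
  Eval-left {m = m} {n} = left m n

  Eval-right : ∀ {p m n} → Eval p right ⟪ m , n ⟫ n
  Eval-right {m = m} {n} = right m n

  Eval-pairing : ∀ {p c d x y z} → Eval p c x y → Eval p d x z → Eval p (pairing c d) x ⟪ y , z ⟫
  Eval-pairing = pairing

  Eval-prec-0 : ∀ {p c d a y} → Eval p c a y → Eval p (prec c d) ⟪ a , 0 ⟫ y
  Eval-prec-0 {a = a} e = prec-0 a e

  Eval-prec-s : ∀ {p c d a n y z} → Eval p (prec c d) ⟪ a , n ⟫ y →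
                Eval p d ⟪ a , ⟪ n , y ⟫ ⟫ z → Eval p (prec c d) ⟪ a , suc n ⟫ z
  Eval-prec-s {a = a} {n} e f = prec-s a n e f

Eval-proj₁ : ∀ {p} z → Eval p left z (proj₁ (unpair z))
Eval-proj₁ {p} z = subst (λ w → Eval p left w (proj₁ (unpair z))) (⟪⟫-unpair z) Eval-left

Eval-proj₂ : ∀ {p} z → Eval p right z (proj₂ (unpair z))
Eval-proj₂ {p} z = subst (λ w → Eval p right w (proj₂ (unpair z))) (⟪⟫-unpair z) Eval-right

-- `Code` has no constructor for the identity, but every number is a pair.
identity : Code
identity = pairing left right

Eval-identity : ∀ {p} z → Eval p identity z z
Eval-identity {p} z =
  subst (Eval p identity z) (⟪⟫-unpair z) (Eval-pairing (Eval-proj₁ z) (Eval-proj₂ z))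

-- Total programs with variables

infixr 5 _▹_

-- Terms denote total functions, so one compilation proof replaces an `Eval` derivation per program.
-- `app` runs a one-variable term in a fresh environment, which avoids weakening.
data Term (k : ℕ) : Set where
  var    : Fin k → Term k
  lit    : ℕ → Term k
  inc    : Term k → Term k
  query  : Term k → Term k
  _▹_    : Term k → Term k → Term k
  split  : Term k → Term (2 + k) → Term k
  switch : Term k → List (Term k) → Term k
  rec    : Term k → Term k → Term (2 + k) → Term k
  app    : Term 1 → Term k → Term k

select : ℕ → List ℕ → ℕ
-- The default 0 agrees with the code `zero` for the empty list in `compile*`.
select n       []       = 0
select zero    (x ∷ xs) = x
select (suc n) (x ∷ xs) = select n xs

primrec : ℕ → ℕ → (ℕ → ℕ → ℕ) → ℕ
primrec zero    b s = b
primrec (suc n) b s = s n (primrec n b s)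

mutual
  ⟦_⟧ : ∀ {k} → Term k → Baire → Vec ℕ k → ℕ
  ⟦ var i ⟧       p ρ = lookup ρ i
  ⟦ lit n ⟧       p ρ = n
  ⟦ inc t ⟧       p ρ = suc (⟦ t ⟧ p ρ)
  ⟦ query t ⟧     p ρ = p (⟦ t ⟧ p ρ)
  ⟦ t ▹ u ⟧       p ρ = ⟪ ⟦ t ⟧ p ρ , ⟦ u ⟧ p ρ ⟫
  ⟦ split t u ⟧   p ρ =
    ⟦ u ⟧ p (proj₁ (unpair (⟦ t ⟧ p ρ)) ∷ proj₂ (unpair (⟦ t ⟧ p ρ)) ∷ ρ)
  ⟦ switch t us ⟧ p ρ = select (⟦ t ⟧ p ρ) (⟦ us ⟧* p ρ)
  ⟦ rec t b s ⟧   p ρ = primrec (⟦ t ⟧ p ρ) (⟦ b ⟧ p ρ) (λ n y → ⟦ s ⟧ p (n ∷ y ∷ ρ))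
  ⟦ app f t ⟧     p ρ = ⟦ f ⟧ p (⟦ t ⟧ p ρ ∷ [])

  ⟦_⟧* : ∀ {k} → List (Term k) → Baire → Vec ℕ k → List ℕ
  ⟦ [] ⟧*     p ρ = []
  ⟦ t ∷ ts ⟧* p ρ = ⟦ t ⟧ p ρ ∷ ⟦ ts ⟧* p ρ

primrec-cong : ∀ n {b b′ s s′} → b ≡ b′ → (∀ m y → s m y ≡ s′ m y) →
               primrec n b s ≡ primrec n b′ s′
primrec-cong zero    e d = e
primrec-cong (suc n) {s = s} e d = trans (cong (s n) (primrec-cong n e d)) (d n _)

mutual
  ⟦⟧-cong : ∀ {k} (t : Term k) {p q} → p ≗ q → ∀ ρ → ⟦ t ⟧ p ρ ≡ ⟦ t ⟧ q ρ
  ⟦⟧-cong (var i)       e ρ = refl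
  ⟦⟧-cong (lit n)       e ρ = refl
  ⟦⟧-cong (inc t)       e ρ = cong suc (⟦⟧-cong t e ρ)
  ⟦⟧-cong (query t) {p} e ρ = trans (cong p (⟦⟧-cong t e ρ)) (e _)
  ⟦⟧-cong (t ▹ u)       e ρ = cong₂ ⟪_,_⟫ (⟦⟧-cong t e ρ) (⟦⟧-cong u e ρ)
  ⟦⟧-cong (split t u)   e ρ rewrite ⟦⟧-cong t e ρ = ⟦⟧-cong u e _
  ⟦⟧-cong (switch t us) e ρ = cong₂ select (⟦⟧-cong t e ρ) (⟦⟧*-cong us e ρ)
  ⟦⟧-cong (rec t b s) {q = q} e ρ rewrite ⟦⟧-cong t e ρ =
    primrec-cong (⟦ t ⟧ q ρ) (⟦⟧-cong b e ρ) (λ n y → ⟦⟧-cong s e (n ∷ y ∷ ρ))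
  ⟦⟧-cong (app f t)     e ρ rewrite ⟦⟧-cong t e ρ = ⟦⟧-cong f e _

  ⟦⟧*-cong : ∀ {k} (ts : List (Term k)) {p q} → p ≗ q → ∀ ρ → ⟦ ts ⟧* p ρ ≡ ⟦ ts ⟧* q ρ
  ⟦⟧*-cong []       e ρ = refl
  ⟦⟧*-cong (t ∷ ts) e ρ = cong₂ _∷_ (⟦⟧-cong t e ρ) (⟦⟧*-cong ts e ρ)

encode : ∀ {k} → Vec ℕ k → ℕ
encode []      = 0
encode (x ∷ ρ) = ⟪ x , encode ρ ⟫

compileVar : ∀ {k} → Fin k → Code
compileVar zero    = left
compileVar (suc i) = comp (compileVar i) right

compileLit : ℕ → Code
compileLit zero    = zero
compileLit (suc n) = comp succ (compileLit n)

mutual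
  compile : ∀ {k} → Term k → Code
  compile (var i)       = compileVar i
  compile (lit n)       = compileLit n
  compile (inc t)       = comp succ (compile t)
  compile (query t)     = comp oracle (compile t)
  compile (t ▹ u)       = pairing (compile t) (compile u)
  compile (split t u)   =
    comp (compile u) (pairing (comp left (compile t)) (pairing (comp right (compile t)) identity))
  compile (switch t us) = comp (compile* us) (pairing identity (compile t))
  compile (rec t b s)   =
    comp (prec (compile b)
               -- `prec` supplies `⟪ ρ , ⟪ n , y ⟫ ⟫`, while `s` expects the environment
               -- `⟪ n , ⟪ y , ρ ⟫ ⟫`.
               (comp (compile s) (pairing (comp left right) (pairing (comp right right) left))))
         (pairing identity (compile t))
  compile (app f t)     = comp (compile f) (pairing (compile t) zero)

  -- Here `prec` serves as a case distinction: at a successor the recursive value is discarded and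
  -- the tail is consulted at the predecessor.
  compile* : ∀ {k} → List (Term k) → Code
  compile* []       = zero
  compile* (t ∷ ts) = prec (compile t) (comp (compile* ts) (pairing left (comp left right)))

Eval-var : ∀ {p k} (i : Fin k) ρ → Eval p (compileVar i) (encode ρ) (lookup ρ i)
Eval-var zero    (x ∷ ρ) = Eval-left
Eval-var (suc i) (x ∷ ρ) = comp Eval-right (Eval-var i ρ)

Eval-lit : ∀ {p x} n → Eval p (compileLit n) x n
Eval-lit zero    = zero
Eval-lit (suc n) = comp (Eval-lit n) succ

mutual
  Eval-compile : ∀ {p k} (t : Term k) ρ → Eval p (compile t) (encode ρ) (⟦ t ⟧ p ρ)
  Eval-compile (var i)       ρ = Eval-var i ρ
  Eval-compile (lit n)       ρ = Eval-lit n
  Eval-compile (inc t)       ρ = comp (Eval-compile t ρ) succ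
  Eval-compile (query t)     ρ = comp (Eval-compile t ρ) oracle
  Eval-compile (t ▹ u)       ρ = Eval-pairing (Eval-compile t ρ) (Eval-compile u ρ)
  Eval-compile (split t u)   ρ =
    comp (Eval-pairing (comp (Eval-compile t ρ) (Eval-proj₁ _))
                       (Eval-pairing (comp (Eval-compile t ρ) (Eval-proj₂ _)) (Eval-identity _)))
         (Eval-compile u _)
  Eval-compile (switch t us) ρ =
    comp (Eval-pairing (Eval-identity _) (Eval-compile t ρ)) (Eval-compile* us _ ρ)
  Eval-compile {p} (rec t b s) ρ =
    comp (Eval-pairing (Eval-identity _) (Eval-compile t ρ)) (loop (⟦ t ⟧ p ρ))
    where
    loop : ∀ n → Eval p _ ⟪ encode ρ , n ⟫ (primrec n (⟦ b ⟧ p ρ) (λ n y → ⟦ s ⟧ p (n ∷ y ∷ ρ)))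
    loop zero    = Eval-prec-0 (Eval-compile b ρ)
    loop (suc n) = Eval-prec-s (loop n)
      (comp (Eval-pairing (comp Eval-right Eval-left)
                          (Eval-pairing (comp Eval-right Eval-right) Eval-left))
            (Eval-compile s (_ ∷ _ ∷ ρ)))
  Eval-compile (app f t)     ρ = comp (Eval-pairing (Eval-compile t ρ) zero) (Eval-compile f _)

  Eval-compile* : ∀ {p k} (ts : List (Term k)) n ρ →
                  Eval p (compile* ts) ⟪ encode ρ , n ⟫ (select n (⟦ ts ⟧* p ρ))
  Eval-compile* []       n       ρ = zero
  Eval-compile* (t ∷ ts) zero    ρ = Eval-prec-0 (Eval-compile t ρ)
  Eval-compile* (t ∷ ts) (suc n) ρ = Eval-prec-s (Eval-compile* (t ∷ ts) n ρ)
    (comp (Eval-pairing Eval-left (comp Eval-right Eval-left)) (Eval-compile* ts n ρ))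

eval : Term 1 → Baire → Baire
eval t p n = ⟦ t ⟧ p (n ∷ [])

program : Term 1 → Code
program t = comp (compile t) (pairing identity zero)

Computes-program : ∀ t {p} → Computes (program t) p (eval t p)
Computes-program t n = comp (Eval-pairing (Eval-identity n) zero) (Eval-compile t (n ∷ []))

-- A universal machine

-- An instruction is ⟪ tag , argument ⟫ and a state is ⟪ ⟪ instruction , stack ⟫ , value ⟫.
-- Tags 0 to 8 are the constructors of Code; the others are the continuations
-- 9: evaluate the second component of a pair, 10: pair the argument with the value,
-- 11: continue an unbounded search, 12: output the value and start on the next input.
⌜_⌝ : Code → ℕ
⌜ zero ⌝        = ⟪ 0 , 0 ⟫
⌜ succ ⌝        = ⟪ 1 , 0 ⟫
⌜ left ⌝        = ⟪ 2 , 0 ⟫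
⌜ right ⌝       = ⟪ 3 , 0 ⟫
⌜ oracle ⌝      = ⟪ 4 , 0 ⟫
⌜ pairing c d ⌝ = ⟪ 5 , ⟪ ⌜ c ⌝ , ⌜ d ⌝ ⟫ ⟫
⌜ comp c d ⌝    = ⟪ 6 , ⟪ ⌜ c ⌝ , ⌜ d ⌝ ⟫ ⟫
⌜ prec c d ⌝    = ⟪ 7 , ⟪ ⌜ c ⌝ , ⌜ d ⌝ ⟫ ⟫
⌜ rfind c ⌝     = ⟪ 8 , ⌜ c ⌝ ⟫

-- Indexed by tags; the variables are laid out as in `environment` below.
transitions : List (Term 11)
transitions =
    (stack ▹ lit 0)
  ∷ (stack ▹ inc value)
  ∷ (stack ▹ value₁)
  ∷ (stack ▹ value₂)
  ∷ (stack ▹ query value)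
  ∷ ((arg₁ ▹ (lit 9 ▹ arg₂ ▹ value) ▹ stack) ▹ value)
  ∷ ((arg₂ ▹ arg₁ ▹ stack) ▹ value)
  -- Case distinction on the counter. At a successor the same instruction runs on `⟪ a , n ⟫`; two
  -- continuations 10 then turn its result `y` into `⟪ a , ⟪ n , y ⟫ ⟫`, the input of the second
  -- program.
  ∷ rec value₂
      ((arg₁ ▹ stack) ▹ value₁)
      ((var (# 8) ▹ (lit 10 ▹ var (# 0)) ▹ (lit 10 ▹ var (# 2)) ▹ var (# 5) ▹ var (# 9))
        ▹ var (# 2) ▹ var (# 0))
  ∷ ((arg ▹ (lit 11 ▹ arg ▹ value ▹ lit 0) ▹ stack) ▹ value ▹ lit 0)
  ∷ ((arg₁ ▹ (lit 10 ▹ value) ▹ stack) ▹ arg₂)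
  ∷ (stack ▹ arg ▹ value)
  -- The argument holds the program, `a` and the candidate `m`. Value 0 returns `m`, any other value
  -- retries with `suc m`. Variables shift by two under `split` and again under the step of `rec`.
  ∷ split arg₂
      (rec (var (# 11))
        (var (# 9) ▹ var (# 1))
        ((var (# 6) ▹ (lit 11 ▹ var (# 6) ▹ var (# 2) ▹ inc (var (# 3))) ▹ var (# 11))
          ▹ var (# 2) ▹ inc (var (# 3))))
  ∷ ((arg₁ ▹ (lit 12 ▹ arg₁ ▹ inc arg₂) ▹ stack) ▹ arg₁ ▹ inc arg₂)
  ∷ []
  where
  value₁ value₂ arg₁ arg₂ arg stack value : Term 11
  value₁ = var (# 0)
  value₂ = var (# 1)
  arg₁   = var (# 2)
  arg₂   = var (# 3)
  arg    = var (# 5)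
  stack  = var (# 7)
  value  = var (# 9)

step : Term 1
step =
  split (var (# 0)) (split (var (# 0)) (split (var (# 0)) (split (var (# 1))
    (split (var (# 7)) (switch (var (# 4)) transitions)))))

-- Only tag 12 emits; the value is raised by one since the completion deletes zeros.
output : Term 1
output =
  split (var (# 0)) (split (var (# 0)) (split (var (# 0))
    (switch (var (# 0)) (zeros 12 (inc (var (# 5)))))))
  where
  zeros : ∀ {k} → ℕ → Term k → List (Term k)
  zeros zero    t = t ∷ []
  zeros (suc n) t = lit 0 ∷ zeros n t

state : ℕ → ℕ → ℕ → ℕ → ℕ
state t w s x = ⟪ ⟪ ⟪ t , w ⟫ , s ⟫ , x ⟫

-- Exchanges, in the value of a state, the `pair` of the `Eval` constructors and the opaque `⟪_,_⟫`.
transport : (P : ℕ → Set) → ∀ {i x y} → x ≡ y → P ⟪ i , x ⟫ → P ⟪ i , y ⟫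
transport P e h rewrite e = h

environment : ℕ × ℕ → ℕ × ℕ → ℕ → ℕ → ℕ → ℕ → Vec ℕ 11
environment (a , b) (u , v) t w s x =
  a ∷ b ∷ u ∷ v ∷ t ∷ w ∷ ⟪ t , w ⟫ ∷ s ∷ ⟪ ⟪ t , w ⟫ , s ⟫ ∷ x ∷ state t w s x ∷ []

module _ (p : Baire) where

  -- The decompositions of `x` and `w` are parameters: a tag that inspects them receives `unpair-⟪⟫`
  -- where a pair is known, and `refl` otherwise.
  step-state : ∀ t w s x {ab uv} → unpair x ≡ ab → unpair w ≡ uv →
               eval step p (state t w s x) ≡
               select t (⟦ transitions ⟧* p (environment ab uv t w s x))
  step-state t w s x refl refl
    rewrite unpair-⟪⟫ ⟪ ⟪ t , w ⟫ , s ⟫ x | unpair-⟪⟫ ⟪ t , w ⟫ s | unpair-⟪⟫ t w = refl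

  output-state : ∀ t w s x → eval output p (state t w s x) ≡
                 select t (0 ∷ 0 ∷ 0 ∷ 0 ∷ 0 ∷ 0 ∷ 0 ∷ 0 ∷ 0 ∷ 0 ∷ 0 ∷ 0 ∷ suc x ∷ [])
  output-state t w s x
    rewrite unpair-⟪⟫ ⟪ ⟪ t , w ⟫ , s ⟫ x | unpair-⟪⟫ ⟪ t , w ⟫ s | unpair-⟪⟫ t w = refl

  module _ (P : ℕ → Set)
           (silent : ∀ {σ} → eval output p σ ≡ 0 → P (eval step p σ) → P σ) where

    private
      advance : ∀ t w s x {ab uv} → eval output p (state t w s x) ≡ 0 →
                unpair x ≡ ab → unpair w ≡ uv →
                P (select t (⟦ transitions ⟧* p (environment ab uv t w s x))) → P (state t w s x)
      advance t w s x e hx hw h = silent e (subst P (sym (step-state t w s x hx hw)) h)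

    -- In continuation-passing style: any property of states that pulls back along
    -- silent steps pulls back along a terminating computation.
    evaluate : ∀ {c x y} → Eval p c x y → ∀ {s} → P ⟪ s , y ⟫ → P ⟪ ⟪ ⌜ c ⌝ , s ⟫ , x ⟫
    -- Recursion on `j`, the number of candidates left before `n`; each of them has a terminating
    -- derivation with nonzero value.
    search : ∀ {c a n} (k : ℕ → ℕ) → (∀ m → m < n → Eval p c (pair a m) (suc (k m))) →
             Eval p c (pair a n) 0 → ∀ {s} → P ⟪ s , n ⟫ → ∀ j m → j + m ≡ n →
             P ⟪ ⟪ ⌜ c ⌝ , ⟪ ⟪ 11 , ⟪ ⌜ c ⌝ , ⟪ a , m ⟫ ⟫ ⟫ , s ⟫ ⟫ , ⟪ a , m ⟫ ⟫

    evaluate zero {s} h = advance 0 0 s _ (output-state _ _ _ _) refl refl h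
    evaluate succ {s} h = advance 1 0 s _ (output-state _ _ _ _) refl refl h
    evaluate (left m n) {s} h rewrite sym (⟪⟫-pair m n) =
      advance 2 0 s _ (output-state _ _ _ _) (unpair-⟪⟫ m n) refl h
    evaluate (right m n) {s} h rewrite sym (⟪⟫-pair m n) =
      advance 3 0 s _ (output-state _ _ _ _) (unpair-⟪⟫ m n) refl h
    evaluate oracle {s} h = advance 4 0 s _ (output-state _ _ _ _) refl refl h
    evaluate (pairing {y = y} {z} d e) {s} h rewrite sym (⟪⟫-pair y z) =
      advance 5 _ s _ (output-state _ _ _ _) refl (unpair-⟪⟫ _ _)
        (evaluate d (advance 9 _ s _ (output-state _ _ _ _) refl (unpair-⟪⟫ _ _)
          (evaluate e (advance 10 _ s _ (output-state _ _ _ _) refl refl h))))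
    evaluate (comp d e) {s} h =
      advance 6 _ s _ (output-state _ _ _ _) refl (unpair-⟪⟫ _ _) (evaluate d (evaluate e h))
    evaluate (prec-0 a d) {s} h rewrite sym (⟪⟫-pair a 0) =
      advance 7 _ s _ (output-state _ _ _ _) (unpair-⟪⟫ _ _) (unpair-⟪⟫ _ _) (evaluate d h)
    evaluate (prec-s {y = y} a n d e) {s} h rewrite sym (⟪⟫-pair a (suc n)) =
      advance 7 _ s _ (output-state _ _ _ _) (unpair-⟪⟫ _ _) (unpair-⟪⟫ _ _)
        (transport P (sym (⟪⟫-pair a n))
          (evaluate d (advance 10 n _ _ (output-state _ _ _ _) refl refl
            (advance 10 a _ _ (output-state _ _ _ _) refl refl
              (transport P (trans (sym (⟪⟫-pair a _)) (cong ⟪ a ,_⟫ (sym (⟪⟫-pair n y))))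
                (evaluate e h))))))
    evaluate (rfind n k d e) {s} h =
      advance 8 _ s _ (output-state _ _ _ _) refl refl (search k d e h n 0 (+-identityʳ n))

    search {a = a} k d e {s} h zero m refl =
      transport P (sym (⟪⟫-pair a m))
        (evaluate e (advance 11 _ s _ (output-state _ _ _ _) refl (unpair-⟪⟫ _ _)
          -- The `split arg₂` of tag 11 leaves one more `unpair`, which `step-state` does not
          -- resolve.
          (subst (λ w → P ⟪ s , proj₂ w ⟫) (sym (unpair-⟪⟫ a m)) h)))
    search {c} {a} k d e {s} h (suc j) m refl =
      transport P (sym (⟪⟫-pair a m))
        (evaluate (d m (s≤s (m≤n+m m j)))
          (advance 11 _ s _ (output-state _ _ _ _) refl (unpair-⟪⟫ _ _)
            (subst
              (λ w → P ⟪ ⟪ ⌜ c ⌝ , ⟪ ⟪ 11 , ⟪ ⌜ c ⌝ , ⟪ proj₁ w , suc (proj₂ w) ⟫ ⟫ ⟫ , s ⟫ ⟫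
                       , ⟪ proj₁ w , suc (proj₂ w) ⟫ ⟫)
              (sym (unpair-⟪⟫ a m))
              (search k d e h j (suc m) (+-suc j m)))))

-- Transition systems and the words they output

iterate : {S : Set} → (S → S) → S → ℕ → S
iterate step σ zero    = σ
iterate step σ (suc t) = step (iterate step σ t)

-- A transition system that runs through phases 0, 1, …, where phase k outputs
-- zeros followed by suc (q k).
module Phases {S : Set} (step : S → S) (output : S → ℕ) (start : ℕ → S) (q : Baire) where

  outputs : S → Baire
  outputs σ t = output (iterate step σ t)

  -- Being inductive, it allows only finitely many silent steps before the emission. The constructor
  -- `silent` is the closure property that `evaluate` asks for.
  data Yields (k : ℕ) : S → Set where
    silent : ∀ {σ} → output σ ≡ 0 → Yields k (step σ) → Yields k σ
    emit   : ∀ {σ} → output σ ≡ suc (q k) → step σ ≡ start (suc k) → Yields k σ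

  iterate-step : ∀ σ t → iterate step σ (suc t) ≡ iterate step (step σ) t
  iterate-step σ zero    = refl
  iterate-step σ (suc t) = cong step (iterate-step σ t)

  prefix-suc : ∀ σ m → prefix-1 (outputs σ) (suc m) ≡
               letter-1 (output σ) ++ prefix-1 (outputs (step σ)) m
  prefix-suc σ m = cong (λ w → letter-1 (output σ) ++ concatMap letter-1 w)
                        (applyUpTo-cong (cong output ∘ iterate-step σ) m)

  prefix-silent : ∀ {σ} → output σ ≡ 0 → ∀ m →
                  prefix-1 (outputs σ) (suc m) ≡ prefix-1 (outputs (step σ)) m
  prefix-silent {σ} e m =
    trans (prefix-suc σ m) (cong (λ x → letter-1 x ++ prefix-1 (outputs (step σ)) m) e)

  prefix-emit : ∀ {σ k} → output σ ≡ suc (q k) → step σ ≡ start (suc k) → ∀ m →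
                prefix-1 (outputs σ) (suc m) ≡ q k ∷ prefix-1 (outputs (start (suc k))) m
  prefix-emit {σ} e d m =
    trans (prefix-suc σ m) (cong₂ (λ x τ → letter-1 x ++ prefix-1 (outputs τ) m) e d)

  module _ (yields : ∀ k → Yields k (start k)) where

    -- Induction on the number of steps rather than on `Yields`, so that after an emission `yields`
    -- may supply a fresh derivation for the next phase.
    outputs-correct : ∀ m {σ k} → Yields k σ →
                      prefix-1 (outputs σ) m ≡
                      applyUpTo (λ i → q (i + k)) (length (prefix-1 (outputs σ) m))
    outputs-correct zero    _ = refl
    outputs-correct (suc m) {σ} (silent e y)
      rewrite prefix-silent {σ} e m = outputs-correct m y
    outputs-correct (suc m) {σ} {k} (emit e d)
      rewrite prefix-emit {σ} {k} e d m = cong (q k ∷_)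
        (trans (outputs-correct m (yields (suc k)))
               (applyUpTo-cong (λ i → cong q (+-suc i k)) _))

    -- Lexicographic recursion: an emission lowers `m`, a silent step keeps `m` and shortens the
    -- derivation.
    outputs-unbounded : ∀ m {σ k} → Yields k σ → ∃[ t ] m ≤ length (prefix-1 (outputs σ) t)
    outputs-unbounded zero    _ = 0 , z≤n
    outputs-unbounded (suc m) (silent e y) with t , le ← outputs-unbounded (suc m) y =
      suc t , subst (λ w → suc m ≤ length w) (sym (prefix-silent e t)) le
    outputs-unbounded (suc m) {k = k} (emit e d) with t , le ← outputs-unbounded m (yields (suc k)) =
      suc t , subst (λ w → suc m ≤ length w) (sym (prefix-emit e d t)) (s≤s le)

    outputs-1≡ : outputs (start 0) -1≡ q
    outputs-1≡ =
      (λ m → trans (outputs-correct m (yields 0)) (applyUpTo-cong (λ i → cong q (+-identityʳ i)) _))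
      , λ m → outputs-unbounded m (yields 0)

-- The program number is itself the first instruction. Its inputs are `⟪ n , k ⟫` because only row
-- `n` of the computed sequence is wanted.
start : ℕ → ℕ → ℕ
start n k = ⟪ ⟪ n , ⟪ ⟪ 12 , ⟪ n , k ⟫ ⟫ , 0 ⟫ ⟫ , ⟪ n , k ⟫ ⟫

-- Position `t` of row `n` is the output after `t` steps from `start n 0`; this is total even if
-- program `n` never halts.
universal : Term 1
universal = split (var (# 0)) (app output (rec (var (# 1))
  ((var (# 0) ▹ (lit 12 ▹ var (# 0) ▹ lit 0) ▹ lit 0) ▹ var (# 0) ▹ lit 0)
  (app step (var (# 1)))))

-- Since `c` halts on every input, `evaluate` with the predicate `Yields k` leads each phase back to
-- the state with continuation 12 on top, which emits.
universal-1≡ : ∀ {c p q} → Computes c p q →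
               row ⌜ c ⌝ (eval universal p) -1≡ row ⌜ c ⌝ q
universal-1≡ {c} {p} {q} h =
  -1≡-resp row-universal (λ _ → refl) (outputs-1≡ start-yields)
  where
  open Phases (eval step p) (eval output p) (start ⌜ c ⌝) (row ⌜ c ⌝ q)

  start-yields : ∀ k → Yields k (start ⌜ c ⌝ k)
  start-yields k =
    transport (Yields k) (sym (⟪⟫-pair ⌜ c ⌝ k))
      (evaluate p (Yields k) silent (h (pair ⌜ c ⌝ k))
        (emit (output-state p 12 ⟪ ⌜ c ⌝ , k ⟫ 0 _)
              (step-state p 12 ⟪ ⌜ c ⌝ , k ⟫ 0 _ refl (unpair-⟪⟫ ⌜ c ⌝ k))))

  primrec-iterate : ∀ t → primrec t (start ⌜ c ⌝ 0) (λ _ → eval step p) ≡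
                    iterate (eval step p) (start ⌜ c ⌝ 0) t
  primrec-iterate zero    = refl
  primrec-iterate (suc t) = cong (eval step p) (primrec-iterate t)

  row-universal : outputs (start ⌜ c ⌝ 0) ≗ row ⌜ c ⌝ (eval universal p)
  row-universal t rewrite unpair-pair ⌜ c ⌝ t = cong (eval output p) (sym (primrec-iterate t))

-- Computable partial functions

Eval-≗ : ∀ {c p q r} → q ≗ r → Computes c p q → Computes c p r
Eval-≗ {c} {p} e h n = subst (Eval p c n) (e n) (h n)

termₚ : Term 1 → PartialFunction
termₚ t = record
  { Graph      = λ p r → r ≗ eval t p
  ; resp       = λ e d h n → trans (sym (d n)) (trans (h n) (⟦⟧-cong t e (n ∷ [])))
  ; functional = λ h h′ n → trans (h n) (sym (h′ n))
  }

termₚ-computable : ∀ t → Computable (termₚ t)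
termₚ-computable t = program t , λ p r h → Eval-≗ {program t} (sym ∘ h) (Computes-program t)

idₚ-computable : Computable idₚ
idₚ-computable = oracle , λ p r h → Eval-≗ {oracle} h (λ _ → oracle)

∘ₚ-computable : ∀ F G → Computable F → Computable G → Computable (F ∘ₚ G)
∘ₚ-computable F G (c , hc) (d , hd) =
  replaceOracle d c , λ { p r (s , g , f) n → Eval-replaceOracle (hd p s g) (hc s r f n) }

double : ∀ {k} → Term k → Term k
double t = rec t (lit 0) (inc (inc (var (# 1))))

double≡ : ∀ n → primrec n 0 (λ _ y → suc (suc y)) ≡ 2 * n
double≡ zero    = refl
double≡ (suc n) = trans (cong (λ m → suc (suc m)) (double≡ n)) (cong suc (sym (+-suc n (n + 0))))

even odd : Term 1
even = query (double (var (# 0)))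
odd  = query (inc (double (var (# 0))))

even-interleave : ∀ p q → p ≗ eval even (interleave p q)
even-interleave p q n =
  sym (trans (cong (interleave p q) (double≡ n)) (interleave-even p q n))

odd-interleave : ∀ p q → q ≗ eval odd (interleave p q)
odd-interleave p q n =
  sym (trans (cong (interleave p q ∘ suc) (double≡ n)) (interleave-odd p q n))

-- Computing an interleaving

ifzero : ℕ → ℕ → ℕ → ℕ
ifzero n x y = primrec n x (λ _ _ → y)

parity half : ℕ → ℕ
parity n = primrec n 0 (λ _ y → ifzero y 1 0)
half n   = primrec n 0 (λ m y → ifzero (parity m) y (suc y))

parityₜ halfₜ : ∀ {k} → Term k → Term k
parityₜ t = rec t (lit 0) (rec (var (# 1)) (lit 1) (lit 0))
halfₜ t   = rec t (lit 0) (rec (parityₜ (var (# 0))) (var (# 1)) (inc (var (# 3))))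

parity-suc-suc : ∀ n → parity (suc (suc n)) ≡ parity n
parity-suc-suc zero          = refl
parity-suc-suc (suc zero)    = refl
parity-suc-suc (suc (suc n)) = cong (λ y → ifzero (ifzero y 1 0) 1 0) (parity-suc-suc n)

half-suc-suc : ∀ n → half (suc (suc n)) ≡ suc (half n)
half-suc-suc n with parity n
... | zero  = refl
... | suc _ = refl

interleave-half : ∀ p q n → interleave p q n ≡ ifzero (parity n) (p (half n)) (q (half n))
interleave-half p q zero          = refl
interleave-half p q (suc zero)    = refl
interleave-half p q (suc (suc n)) rewrite parity-suc-suc n | half-suc-suc n =
  interleave-half (p ∘ suc) (q ∘ suc) n

Eval-ifzero : ∀ {p x y} n → Eval p (prec left (comp right left)) ⟪ ⟪ x , y ⟫ , n ⟫ (ifzero n x y)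
Eval-ifzero zero    = Eval-prec-0 Eval-left
Eval-ifzero (suc n) = Eval-prec-s (Eval-ifzero n) (comp Eval-left Eval-right)

-- Both programs run at `half n` before the parity selects a value; this halts because both compute
-- total sequences.
interleaveCode : Code → Code → Code
interleaveCode c d = comp (prec left (comp right left))
  (pairing (pairing (comp c (program (halfₜ (var (# 0))))) (comp d (program (halfₜ (var (# 0))))))
           (program (parityₜ (var (# 0)))))

Computes-interleave : ∀ {c d p q r} → Computes c p q → Computes d p r →
                      Computes (interleaveCode c d) p (interleave q r)
Computes-interleave {c} {d} {p} {q} {r} hc hd n =
  subst (Eval p (interleaveCode c d) n) (sym (interleave-half q r n))
    (comp (Eval-pairing
            (Eval-pairing (comp (Computes-program (halfₜ (var (# 0))) n) (hc _))
                          (comp (Computes-program (halfₜ (var (# 0))) n) (hd _)))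
            (Computes-program (parityₜ (var (# 0))) n))
          (Eval-ifzero (parity n)))

interleave-≤T : ∀ {p q r} → q ≤T p → r ≤T p → interleave q r ≤T p
interleave-≤T (c , hc) (d , hd) = interleaveCode c d , Computes-interleave hc hd

odd-≤T : ∀ p q → q ≤T interleave p q
odd-≤T p q = program odd ,
  Eval-≗ {program odd} (sym ∘ odd-interleave p q) (Computes-program odd)

even-≤T : ∀ p q → p ≤T interleave p q
even-≤T p q = program even ,
  Eval-≗ {program even} (sym ∘ even-interleave p q) (Computes-program even)

⟨,⟩ₚ-computable : ∀ F G → Computable F → Computable G → Computable ⟨ F , G ⟩ₚ
⟨,⟩ₚ-computable F G (c , hc) (d , hd) = interleaveCode c d ,
  λ { p r (a , b , f , g , e) →
      Eval-≗ {interleaveCode c d} (sym ∘ e) (Computes-interleave (hc p a f) (hd p b g)) }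

-- Weihrauch reducibility

-- The outer function sees only `p` and the answer for `K′ (K p)`. It recomputes `K p` for `H′`, and
-- then passes `p` and the result of `H′` to `H`.
≤W-trans : {X Y U V S T : RepresentedSpace} {f : Problem X Y} {g : Problem U V} {h : Problem S T} →
           f ≤W g → g ≤W h → f ≤W h
≤W-trans {f = f} {g} {h} (H , K , cH , cK , f≤g) (H′ , K′ , cH′ , cK′ , g≤h) =
    H″ , K′ ∘ₚ K
  , ∘ₚ-computable H ⟨ evenₚ , H′ ∘ₚ J ⟩ₚ cH (⟨,⟩ₚ-computable evenₚ (H′ ∘ₚ J) cEven
      (∘ₚ-computable H′ J cH′ (⟨,⟩ₚ-computable (K ∘ₚ evenₚ) oddₚ
        (∘ₚ-computable K evenₚ cK cEven) (termₚ-computable odd))))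
  , ∘ₚ-computable K′ K cK′ cK
  , realizes
  where
  module K = PartialFunction K
  evenₚ = termₚ even
  oddₚ  = termₚ odd
  cEven = termₚ-computable even
  J  = ⟨ K ∘ₚ evenₚ , oddₚ ⟩ₚ
  H″ = H ∘ₚ ⟨ evenₚ , H′ ∘ₚ J ⟩ₚ

  realizes : ∀ G → Realizes G (multiFunction h) →
             Realizes (H″ ∘ₚ ⟨ idₚ , G ∘ₚ (K′ ∘ₚ K) ⟩ₚ) (multiFunction f)
  realizes G hG p x hp dom
    with f≤g (H′ ∘ₚ ⟨ idₚ , G ∘ₚ K′ ⟩ₚ) (g≤h G hG) p x hp dom
  ... | r , (s , (a , b , p≗a
             , (t , k , s′ , (a′ , b′ , t≗a′ , (t′ , k′ , gr) , e′) , h′) , e) , h) , rest =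
    r , ( interleave p b′
        , (p , b′ , (λ _ → refl) , (t′ , (t , k , k′) , gr) , λ _ → refl)
        , s
        , ( a , b
          , (λ n → trans (sym (p≗a n)) (even-interleave p b′ n))
          , ( s′
            , ( a′ , b′
              , (p , even-interleave p b′ , K.resp (λ _ → refl) t≗a′ k)
              , odd-interleave p b′
              , e′ )
            , h′ )
          , e )
        , h ) , rest

-- A reduction works for every realizer, hence also for one made to give a prescribed answer to a
-- single query.
update : Baire → Baire → PartialFunction → PartialFunction
update s v F = record
  { Graph      = λ t r → (t ≗ s × r ≗ v) ⊎ (¬ t ≗ s × Graph F t r)
  ; resp       = λ
    { e d (inj₁ (t≗s , r≗v)) →
        inj₁ ((λ n → trans (sym (e n)) (t≗s n)) , λ n → trans (sym (d n)) (r≗v n))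
    ; e d (inj₂ (t≇s , h)) →
        inj₂ ((λ t≗s → t≇s λ n → trans (e n) (t≗s n)) , F.resp e d h) }
  ; functional = λ
    { (inj₁ (_ , e)) (inj₁ (_ , d)) n → trans (e n) (sym (d n))
    ; (inj₁ (e , _)) (inj₂ (¬e , _)) → ⊥-elim (¬e e)
    ; (inj₂ (¬e , _)) (inj₁ (e , _)) → ⊥-elim (¬e e)
    ; (inj₂ (_ , h)) (inj₂ (_ , h′)) → F.functional h h′ }
  }
  where module F = PartialFunction F

-- Upper Turing cones and reductions

module _ {U V : RepresentedSpace} (g : Problem U V) where
  private
    module U = RepresentedSpace U
    module V = RepresentedSpace V
    module g = Problem g

  Dom-^𝒟 : ∀ {u} → g.Dom u → Problem.Dom (g ^𝒟) u
  Dom-^𝒟 (y , rel) with q , hq ← V.surjective y =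
    q , q , ≡T-reflexive (λ _ → refl) , y , (q , hq , ≤T-reflexive (λ _ → refl)) , rel

  -- A realizer returns an arbitrary member `v` of the degree, and lower cones are invariant under
  -- `_≡T_`.
  ^𝒟-realized : ∀ {u v} → (∃[ d ] v ≡T d × Problem.Rel (g ^𝒟) u d) →
                ∃[ y ] PointBelow V y v × g.Rel u y
  ^𝒟-realized (d , v≡d , q , d≡q , y , (r , hr , r≤q) , rel) =
    y , (r , hr , ≤T-trans r≤q (≤T-trans (proj₂ d≡q) (proj₂ v≡d))) , rel

  -- All instances named by `s` are equal to `u`, so `v` answers each of them; excluded middle
  -- decides whether a name is `s`.
  update-realizes : ExcludedMiddle 0ℓ → ∀ F {s v u y} → Realizes F g.multiFunction →
                    s U.⊩ u → v V.⊩ y → g.Rel u y → Realizes (update s v F) g.multiFunction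
  update-realizes em F {s} {v} {y = y} hF hs hv rel t u′ ht dom with em {t ≗ s}
  ... | yes t≗s = v , inj₁ (t≗s , λ _ → refl) , y , hv
                , g.resp (U.functional hs (U.resp t≗s U.≈-refl ht)) V.≈-refl rel
  ... | no ¬t≗s with r , gr , rest ← hF t u′ ht dom = r , inj₂ (¬t≗s , gr) , rest

module _ {X Y U V : RepresentedSpace} (f : Problem X Y) (g : Problem U V) where
  private
    module X = RepresentedSpace X
    module U = RepresentedSpace U
    module f = Problem f
    module g = Problem g

  -- The reduction is applied to a realizer of g restricted to names of instances.
  reduction-instance :
    ∀ H K → (∀ G → Realizes G g.multiFunction →
             Realizes (H ∘ₚ ⟨ idₚ , G ∘ₚ K ⟩ₚ) f.multiFunction) →
    ∀ p x → p X.⊩ x → f.Dom x → ∃[ s ] Graph K p s × (∃[ u ] s U.⊩ u × g.Dom u)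
  reduction-instance H K red p x hp dom
    with red F′ realizes p x hp dom
    where
    F = proj₁ g.realizer
    module F = PartialFunction F

    F′ : PartialFunction
    F′ = record
      { Graph      = λ s r → Graph F s r × (∃[ u ] s U.⊩ u × g.Dom u)
      ; resp       = λ { e d (h , u , hu , dom) → F.resp e d h , u , U.resp e U.≈-refl hu , dom }
      ; functional = λ h h′ → F.functional (proj₁ h) (proj₁ h′)
      }

    realizes : Realizes F′ g.multiFunction
    realizes s u hs dom with proj₂ g.realizer s u hs dom
    ... | r , gr , rest = r , (gr , u , hs , dom) , rest
  ... | _ , (_ , (_ , _ , _ , (s , k , _ , inst) , _) , _) , _ = s , k , inst

  -- The degree does not reveal which program computes a solution from `v`. The new outer function
  -- is therefore the identity, and `H` enters only the proof that its output computes a solution.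
  ^𝒟-mono : ExcludedMiddle 0ℓ → f ≤W g → f ^𝒟 ≤W g ^𝒟
  ^𝒟-mono em (H , K , (c , hc) , cK , red) = idₚ , K , idₚ-computable , cK , realizes
    where
    module K = PartialFunction K

    realizes : ∀ G → Realizes G (multiFunction (g ^𝒟)) →
               Realizes (idₚ ∘ₚ ⟨ idₚ , G ∘ₚ K ⟩ₚ) (multiFunction (f ^𝒟))
    realizes G hG p x hp (_ , _ , _ , y₀ , _ , rel₀)
      -- The query `s` has to be known first: the realizer given to `red` below is modified at `s`.
      with s , k , u , hs , dom ← reduction-instance H K red p x hp (y₀ , rel₀)
      with v , gv , realized ← hG s u hs (Dom-^𝒟 g dom)
      with y , (r , hr , r≤v) , rel ← ^𝒟-realized g realized
      with red (update s r (proj₁ g.realizer))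
               (update-realizes g em (proj₁ g.realizer) (proj₂ g.realizer) hs hr rel)
               p x hp (y₀ , rel₀)
    -- Impossible, as `K` is single-valued and the query is `s`.
    ... | _ , (_ , (_ , _ , _ , (_ , k′ , inj₂ (s′≇s , _)) , _) , _) , _ =
      ⊥-elim (s′≇s (K.functional k′ k))
    ... | w , (o , (a , b , p≗a , (_ , _ , inj₁ (_ , b≗r)) , e) , h) , y′ , hw , rel′ =
      interleave p v
      , (interleave p v , (p , v , (λ _ → refl) , (s , k , gv) , λ _ → refl) , λ _ → refl)
      , interleave p v , ≡T-reflexive (λ _ → refl)
      , interleave p v , ≡T-reflexive (λ _ → refl)
      , y′ , (w , hw , w≤) , rel′
      where
      w≤ : w ≤T interleave p v
      w≤ = ≤T-trans (c , hc o w h) (≤T-trans (≤T-reflexive e) (interleave-≤T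
             (≤T-trans (≤T-reflexive (sym ∘ p≗a)) (even-≤T p v))
             (≤T-trans (≤T-reflexive b≗r) (≤T-trans r≤v (odd-≤T p v)))))

module _ {X Y : RepresentedSpace} (f : Problem X Y) where

  -- A name of a solution is also a name of its own degree, which lies in the cone.
  ^𝒟-≤W : f ^𝒟 ≤W f
  ^𝒟-≤W = termₚ odd , idₚ , termₚ-computable odd , idₚ-computable , realizes
    where
    realizes : ∀ G → Realizes G (multiFunction f) →
               Realizes (termₚ odd ∘ₚ ⟨ idₚ , G ∘ₚ idₚ ⟩ₚ) (multiFunction (f ^𝒟))
    realizes G hG p x hp (_ , _ , _ , y₀ , _ , rel₀)
      with r , gr , y , hr , rel ← hG p x hp (y₀ , rel₀) =
      r
      , ( interleave p r , (p , r , (λ _ → refl) , (p , (λ _ → refl) , gr) , λ _ → refl)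
        , odd-interleave p r )
      , r , ≡T-reflexive (λ _ → refl)
      , r , ≡T-reflexive (λ _ → refl) , y , (r , hr , ≤T-reflexive (λ _ → refl)) , rel

  Stashing-≤W : ExcludedMiddle 0ℓ → Stashing f ≤W Parallelization f ^𝒟
  Stashing-≤W em =
      termₚ universal ∘ₚ termₚ odd , idₚ
    , ∘ₚ-computable (termₚ universal) (termₚ odd) (termₚ-computable universal) (termₚ-computable odd)
    , idₚ-computable
    , realizes
    where
    module Ȳ = RepresentedSpace (Completion Y)

    realizes : ∀ G → Realizes G (multiFunction (Parallelization f ^𝒟)) →
               Realizes ((termₚ universal ∘ₚ termₚ odd) ∘ₚ ⟨ idₚ , G ∘ₚ idₚ ⟩ₚ)
                        (multiFunction (Stashing f))
    realizes G hG p xs hp (_ , dom , _)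
      with v , gv , realized ← hG p xs hp (Dom-^𝒟 (Parallelization f)
                                 (proj₁ ∘ dom , proj₂ ∘ dom))
      with ys , (r , hr , c , hc) , rel ← ^𝒟-realized (Parallelization f) realized =
      w
      , ( interleave p v , (p , v , (λ _ → refl) , (p , (λ _ → refl) , gv) , λ _ → refl)
        , v , odd-interleave p v , λ _ → refl )
      , (λ n → proj₁ (point n)) , (λ n → proj₂ (point n))
      , dom , ⌜ c ⌝ , ys ⌜ c ⌝
      -- The point chosen by excluded middle at index `⌜ c ⌝` agrees with `ys ⌜ c ⌝`, since both
      -- have the same name.
      , Ȳ.functional (proj₂ (point ⌜ c ⌝)) (row ⌜ c ⌝ r , universal-1≡ hc , hr ⌜ c ⌝)
      , rel ⌜ c ⌝
      where
      w = eval universal v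
      point : ∀ n → ∃[ z ] row n w Ȳ.⊩ z
      point n = Completion-total em Y (row n w)

corollary1p16 : ExcludedMiddle 0ℓ →
    {X Y : RepresentedSpace} (f : Problem X Y) →
    Parallelizable f → Stashable f → ClosedUnderUpperTuringCones f
corollary1p16 em f (_ , Πf≤f) (f≤Σf , _) =
    ≤W-trans {f = f} {Stashing f} {f ^𝒟} f≤Σf
      (≤W-trans {f = Stashing f} {Parallelization f ^𝒟} {f ^𝒟} (Stashing-≤W f em)
        (^𝒟-mono (Parallelization f) f em Πf≤f))
  , ^𝒟-≤W f
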